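{- $\mathrm{BndSafety}$ and $\mathrm{RecMC}$ are sound. That is, for every program $\mathcal{A}$ with main procedure $M$ and every safety property $\varphi_{\mathrm{safe}}$ of $M$: (1) for every $n\ge 0$, if a run of $\mathrm{BndSafety}(\mathcal{A},\varphi_{\mathrm{safe}},n,\emptyset,\emptyset)$ returns UNSAFE (i.e. the premises of rule Unsafe hold), then $M\not\models_n\varphi_{\mathrm{safe}}$; and if it returns SAFE (i.e. the premises of rule Safe hold), then $M\models_n\varphi_{\mathrm{safe}}$; (2) if a run of $\mathrm{RecMC}(\mathcal{A},\varphi_{\mathrm{safe}})$ returns UNSAFE, then $M\not\models\varphi_{\mathrm{safe}}$; and if it returns SAFE, then $M\models\varphi_{\mathrm{safe}}$.
   Context: **Logic.** Fix a first-order language with equality with signature $\mathcal{S}$ (non-logical symbols) and an $\mathcal{S}$-theory $\mathit{Th}$ (a deductively closed set of $\mathcal{S}$-sentences). For an $\mathcal{S}$-formula $\psi$, $\models\psi$ means that $\psi$ holds in every model of $\mathit{Th}$ under every assignment of its free variables, and $\not\models\psi$ is its negation. For an $\mathcal{S}$-structure $I$ with domain $|I|$ and a formula $\varphi(\bar x)$, $I(\varphi)$ is the set of $\bar a\in|I|^{|\bar x|}$ satisfying $\varphi$ in $I$ (a truth value if $\bar x$ is empty, with true identified with $|I|$ and false with $\emptyset$). **Programs.** A program $\mathcal{A}=\langle P_0,\dots,P_m\rangle$ is a finite list of procedures with a designated main procedure $M$. A procedure $P$ is a tuple $\langle\bar\iota_P,\bar o_P,\Sigma_P,\bar\ell_P,\beta_P\rangle$: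 finite lists of input variables $\bar\iota_P$, output variables $\bar o_P$ and local variables $\bar\ell_P$; a fresh predicate symbol $\Sigma_P$ of arity $|\bar\iota_P|+|\bar o_P|$; and a body $\beta_P$, a quantifier-free formula over $\mathcal{S}\cup\{\Sigma_Q : Q\in\mathcal{A}\}$ with variables among $\bar\iota_P,\bar o_P,\bar\ell_P$, in which every $\Sigma_Q$ occurs only positively. Put $\bar v_P=\bar\iota_P\cup\bar o_P$. $\mathit{Paths}(P)$ is the set of prime implicants (conjunctions of literals) of $\beta_P$. **Semantics.** For an $\mathcal{S}$-structure $I$ and a list $\bar X=\langle X_0,\dots,X_m\rangle$ with $X_i\subseteq|I|^{|\bar v_{P_i}|}$ (a truth value if $|\bar v_{P_i}|=0$), $J(I,\bar X)$ is the expansion of $I$ interpreting each $\Sigma_{P_i}$ as $X_i$. $\langle[\![P_0]\!]_I,\dots,[\![P_m]\!]_I\rangle$ is the pointwise least $\bar X$ such that $J(I,\bar X)\models\forall\bar v_Q\cup\bar\ell_Q\,(\beta_Q\Rightarrow\Sigma_Q(\bar v_Q))$ for all $Q\in\mathcal{A}$. The bounded semantics is $[\![P_i]\!]^0_I=J(I,\langle\emptyset,\dots,\emptyset\rangle)(\exists\bar\ell_{P_i}.\beta_{P_i})$ and $[\![P_i]\!]^b_I=J(I,\langle[\![P_0]\!]^{b-1}_I,\dots,[\![P_m]\!]^{b-1}_I\rangle)(\exists\bar\ell_{P_i}.\beta_{P_i})$ for $b\ge1$. A safety property of $P$ is a formula $\varphi$ over $\bar v_P$; $P\models\varphi$ iff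 $[\![P]\!]_I\subseteq I(\varphi)$ for all models $I$ of $\mathit{Th}$; $P\models_b\varphi$ iff $[\![P]\!]^b_I\subseteq I(\varphi)$ for all models $I$ of $\mathit{Th}$. **Maps.** A bounded assertion map $m$ maps each pair (procedure $P$, natural number $b$) to a set of formulas over $\bar v_P$; $m\cup\{\langle P,b\rangle\mapsto\psi\}$ adds $\psi$ to $m(P,b)$; $\emptyset$ is the map with all values empty. For $b\ge0$, $U^b_m(\Sigma_P)=\bigvee\{\delta\in m(P,b') : b'\le b\}$ and $O^b_m(\Sigma_P)=\bigwedge\{\delta\in m(P,b') : b'\ge b\}$ (empty disjunction $\bot$, empty conjunction $\top$); $U^{ -1}_m$ and $O^{ -1}_m$ map every $\Sigma_P$ to $\bot$. For a formula $\tau$, $[\![\tau]\!]^b_\rho$ (resp. $[\![\tau]\!]^b_\sigma$) is $\tau$ with every $\Sigma_P$ instantiated by $U^b_\rho(\Sigma_P)$ (resp. $O^b_\sigma(\Sigma_P)$); $[\![\Sigma_P]\!]$ abbreviates $[\![\Sigma_P(\bar v_P)]\!]$. **$\mathrm{BndSafety}(\mathcal{A},\varphi_{\mathrm{safe}},n,\rho_{\mathrm{Init}},\sigma_{\mathrm{Init}})$** is a nondeterministic transition system. States are triples $\mathcal{Q}\parallel\rho\parallel\sigma$ with bounded assertion maps $\rho$ (reachability facts), $\sigma$ (summary facts) and a set $\mathcal{Q}$ of queries $\langle P,\varphi,b\rangle$ ($P$ a procedure, $\varphi$ a formula over $\bar v_P$, $b\ge0$). Rules: - Init: the initial state is $\{\langle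 M,\neg\varphi_{\mathrm{safe}},n\rangle\}\parallel\rho_{\mathrm{Init}}\parallel\sigma_{\mathrm{Init}}$. - Sum: if $\langle P,\varphi,b\rangle\in\mathcal{Q}$ and $\models[\![\beta_P]\!]^{b-1}_\sigma\Rightarrow\neg\varphi$, choose an interpolant $\psi$, i.e. a formula over $\bar v_P$ with $\models[\![\beta_P]\!]^{b-1}_\sigma\Rightarrow\psi$ and $\models\psi\Rightarrow\neg\varphi$; add $\langle P,b\rangle\mapsto\psi$ to $\sigma$ and remove from $\mathcal{Q}$ all $\langle P,\eta,c\rangle$ with $c\le b$ and $\models[\![\Sigma_P]\!]^c_\sigma\wedge\psi\Rightarrow\neg\eta$ (with the old $\sigma$). - Reach: if $\langle P,\varphi,b\rangle\in\mathcal{Q}$, $\pi\in\mathit{Paths}(P)$ and $\not\models[\![\pi]\!]^{b-1}_\rho\Rightarrow\neg\varphi$, let $\psi=\exists\bar\ell_P.[\![\pi]\!]^{b-1}_\rho$; add $\langle P,b\rangle\mapsto\psi$ to $\rho$ and remove from $\mathcal{Q}$ all $\langle P,\eta,c\rangle$ with $c\ge b$ and $\not\models\psi\Rightarrow\neg\eta$. - Query: if $\langle P,\varphi,b\rangle\in\mathcal{Q}$, $\models[\![\beta_P]\!]^{b-1}_\rho\Rightarrow\neg\varphi$, $\pi\in\mathit{Paths}(P)$, $\pi=\pi_u\wedge\Sigma_R(\bar a)\wedge\pi_v$ (a prefix, a call, a suffix), $\models[\![\pi_u]\!]^{b-1}_\sigma\wedge[\![\Sigma_R(\bar a)]\!]^{b-1}_\rho\wedge[\![\pi_v]\!]^{b-1}_\rho\Rightarrow\neg\varphi$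 and $\not\models[\![\pi_u]\!]^{b-1}_\sigma\wedge[\![\Sigma_R(\bar a)]\!]^{b-1}_\sigma\wedge[\![\pi_v]\!]^{b-1}_\rho\Rightarrow\neg\varphi$, let $\psi=(\exists(\bar v_P\cup\bar\ell_P)\setminus\bar a.\ [\![\pi_u]\!]^{b-1}_\sigma\wedge[\![\pi_v]\!]^{b-1}_\rho\wedge\varphi)[\bar a\leftarrow\bar v_R]$; if $\models\psi\Rightarrow\neg\eta$ for all $\langle R,\eta,b-1\rangle\in\mathcal{Q}$, add $\langle R,\psi,b-1\rangle$ to $\mathcal{Q}$. - Unsafe: if $\mathcal{Q}=\emptyset$ and $\not\models[\![\Sigma_M]\!]^n_\rho\Rightarrow\varphi_{\mathrm{safe}}$, return UNSAFE. - Safe: if $\mathcal{Q}=\emptyset$ and $\models[\![\Sigma_M]\!]^n_\sigma\Rightarrow\varphi_{\mathrm{safe}}$, return SAFE. **$\mathrm{RecMC}(\mathcal{A},\varphi_{\mathrm{safe}})$.** Start with $n=0$, $\rho=\sigma=\emptyset$ and loop: run $\mathrm{BndSafety}(\mathcal{A},\varphi_{\mathrm{safe}},n,\rho,\sigma)$ and update $\rho,\sigma$ to its final maps. If it returns UNSAFE, return UNSAFE. Otherwise run CheckInductive: for each $P\in\mathcal{A}$ and $\delta\in\sigma(P,n)$, if $\models[\![\beta_P]\!]^n_\sigma\Rightarrow\delta$ then add $\langle P,n+1\rangle\mapsto\delta$ to $\sigma$; CheckInductive succeeds iff this test succeeds for all such $P,\delta$. If it succeeds return SAFE; otherwise set $n:=n+1$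 and repeat. -}

module Defs where

open import Data.Empty using (⊥)
open import Data.Fin using (Fin; _↑ˡ_; _↑ʳ_)
import Data.Fin as Fin
import Data.Fin.Properties as Fin
open import Data.Integer using (ℤ; +_; -[1+_]; pred)
open import Data.List using (List; []; _∷_; _++_; foldr; map; filter; length; allFin)
open import Data.List.Membership.Propositional using (_∈_)
open import Data.List.Membership.Propositional.Properties using (∈-filter⁺; ∈-allFin)
open import Data.List.Relation.Binary.Subset.Propositional using () renaming (_⊆_ to _⊆ᴸ_)
open import Data.List.Relation.Unary.All using (All)
open import Data.List.Relation.Unary.Any using (index)
open import Data.List.Relation.Unary.Unique.Propositional using (Unique)
open import Data.Nat using (ℕ; zero; suc; _+_; _≤_; _≤?_; _≥_; _≥?_)
open import Data.Product using (_×_; _,_; proj₁; proj₂; ∃; ∃-syntax)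
open import Data.Sum using (_⊎_; inj₁; inj₂; [_,_]′)
open import Data.Unit using (⊤)
open import Data.Vec using (Vec; []; _∷_; lookup; tabulate)
open import Function using (_∘_; _⇔_; mk⇔)
open import Level using (Lift; 0ℓ) renaming (suc to lsuc)
open import Relation.Binary.Construct.Closure.ReflexiveTransitive using (Star)
open import Relation.Binary.PropositionalEquality using (_≡_; refl)
open import Relation.Nullary using (Dec; yes; no; ¬_; ¬?)
open import Relation.Unary using (Pred; Empty; _⊆_; _∪_; _∖_)

-- Formulas are well scoped: `Formula S n` has its free variables in
-- `Fin n`, and a quantifier binds variable 0 of its scope.

record Symbols : Set₁ where
  field
    Symbol : Set
    arity  : Symbol → ℕ

open Symbols public

record Signature : Set₁ where
  field
    functions : Symbols
    relations : Symbols

open Signature public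

data Term (F : Symbols) (n : ℕ) : Set where
  var : Fin n → Term F n
  app : (f : Symbol F) → Vec (Term F n) (arity F f) → Term F n

data Atom (S : Signature) (n : ℕ) : Set where
  _≐_ : Term (functions S) n → Term (functions S) n → Atom S n
  rel : (r : Symbol (relations S)) →
        Vec (Term (functions S) n) (arity (relations S) r) → Atom S n

infixr 7 _∧ᶠ_
infixr 6 _∨ᶠ_
infixr 5 _⇒ᶠ_
infix  8 ¬ᶠ_
infix  9 _≐_

data Formula (S : Signature) (n : ℕ) : Set where
  atom           : Atom S n → Formula S n
  ⊤ᶠ ⊥ᶠ          : Formula S n
  _∧ᶠ_ _∨ᶠ_ _⇒ᶠ_ : Formula S n → Formula S n → Formula S n
  ∃ᶠ_ ∀ᶠ_        : Formula S (suc n) → Formula S n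

Sentence : Signature → Set
Sentence S = Formula S 0

private
  variable
    F : Symbols
    S : Signature
    k l n : ℕ

¬ᶠ_ : Formula S n → Formula S n
¬ᶠ φ = φ ⇒ᶠ ⊥ᶠ

⋀ ⋁ : List (Formula S n) → Formula S n
⋀ = foldr _∧ᶠ_ ⊤ᶠ
⋁ = foldr _∨ᶠ_ ⊥ᶠ

∃* : ∀ l → Formula S (l + n) → Formula S n
∃* zero    φ = φ
∃* (suc l) φ = ∃* l (∃ᶠ φ)

mutual
  substᵗ : (Fin k → Term F n) → Term F k → Term F n
  substᵗ s (var x)    = s x
  substᵗ s (app f ts) = app f (substᵗˢ s ts)

  substᵗˢ : (Fin k → Term F n) → Vec (Term F k) l → Vec (Term F n) l
  substᵗˢ s []       = []
  substᵗˢ s (t ∷ ts) = substᵗ s t ∷ substᵗˢ s ts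

lift : (Fin k → Term F n) → Fin (suc k) → Term F (suc n)
lift s Fin.zero    = var Fin.zero
lift s (Fin.suc x) = substᵗ (var ∘ Fin.suc) (s x)

substᵃ : (Fin k → Term (functions S) n) → Atom S k → Atom S n
substᵃ s (t ≐ u)    = substᵗ s t ≐ substᵗ s u
substᵃ s (rel r ts) = rel r (substᵗˢ s ts)

subst : (Fin k → Term (functions S) n) → Formula S k → Formula S n
subst s (atom a) = atom (substᵃ s a)
subst s ⊤ᶠ       = ⊤ᶠ
subst s ⊥ᶠ       = ⊥ᶠ
subst s (φ ∧ᶠ ψ) = subst s φ ∧ᶠ subst s ψ
subst s (φ ∨ᶠ ψ) = subst s φ ∨ᶠ subst s ψ
subst s (φ ⇒ᶠ ψ) = subst s φ ⇒ᶠ subst s ψ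
subst s (∃ᶠ φ)   = ∃ᶠ subst (lift s) φ
subst s (∀ᶠ φ)   = ∀ᶠ subst (lift s) φ

weaken : ∀ l → Formula S n → Formula S (l + n)
weaken l = subst (var ∘ (l ↑ʳ_))

record Structure (S : Signature) : Set₁ where
  field
    ∣_∣      : Set
    nonempty : ∣_∣
    fun      : (f : Symbol (functions S)) → Vec ∣_∣ (arity (functions S) f) → ∣_∣
    holds    : (r : Symbol (relations S)) → Vec ∣_∣ (arity (relations S) r) → Set

open Structure public

module _ (I : Structure S) where

  mutual
    eval : Vec ∣ I ∣ n → Term (functions S) n → ∣ I ∣
    eval e (var x)    = lookup e x
    eval e (app f ts) = fun I f (evals e ts)

    evals : Vec ∣ I ∣ n → Vec (Term (functions S) n) k → Vec ∣ I ∣ k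
    evals e []       = []
    evals e (t ∷ ts) = eval e t ∷ evals e ts

  satᵃ : Atom S n → Pred (Vec ∣ I ∣ n) 0ℓ
  satᵃ (t ≐ u)    e = eval e t ≡ eval e u
  satᵃ (rel r ts) e = holds I r (evals e ts)

  -- Truth values are sets.  Excluded middle is neither assumed nor refuted,
  -- so classical first-order semantics is the instance where it holds.
  sat : Formula S n → Pred (Vec ∣ I ∣ n) 0ℓ
  sat (atom a) e = satᵃ a e
  sat ⊤ᶠ       e = ⊤
  sat ⊥ᶠ       e = ⊥
  sat (φ ∧ᶠ ψ) e = sat φ e × sat ψ e
  sat (φ ∨ᶠ ψ) e = sat φ e ⊎ sat ψ e
  sat (φ ⇒ᶠ ψ) e = sat φ e → sat ψ e
  sat (∃ᶠ φ)   e = ∃[ d ] sat φ (d ∷ e)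
  sat (∀ᶠ φ)   e = ∀ d → sat φ (d ∷ e)

  Satisfies : Formula S n → Set
  Satisfies φ = ∀ e → sat φ e

record Theory (S : Signature) : Set₂ where
  field
    sentences : Pred (Sentence S) (lsuc 0ℓ)

  IsModel : Structure S → Set₁
  IsModel I = ∀ φ → sentences φ → Satisfies I φ

  field
    deductivelyClosed : ∀ φ → (∀ I → IsModel I → Satisfies I φ) → sentences φ

open Theory public using (IsModel)

infix 4 _⊨_ _⊭_

_⊨_ _⊭_ : Theory S → Formula S n → Set₁
Th ⊨ φ = ∀ I → IsModel Th I → Satisfies I φ
Th ⊭ φ = ¬ (Th ⊨ φ)

data QuantifierFree {S n} : Formula S n → Set where
  atom : ∀ a → QuantifierFree (atom a)
  ⊤ᶠ   : QuantifierFree ⊤ᶠ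
  ⊥ᶠ   : QuantifierFree ⊥ᶠ
  _∧ᶠ_ : ∀ {φ ψ} → QuantifierFree φ → QuantifierFree ψ → QuantifierFree (φ ∧ᶠ ψ)
  _∨ᶠ_ : ∀ {φ ψ} → QuantifierFree φ → QuantifierFree ψ → QuantifierFree (φ ∨ᶠ ψ)
  _⇒ᶠ_ : ∀ {φ ψ} → QuantifierFree φ → QuantifierFree ψ → QuantifierFree (φ ⇒ᶠ ψ)

-- Propositional semantics, with the same truth values as sat: atoms,
-- equations included, are independent propositional variables.
Valuation : Signature → ℕ → Set₁
Valuation S n = Atom S n → Set

eval-qf : Valuation S n → {φ : Formula S n} → QuantifierFree φ → Set
eval-qf v (atom a) = v a
eval-qf v ⊤ᶠ       = ⊤
eval-qf v ⊥ᶠ       = ⊥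
eval-qf v (p ∧ᶠ q) = eval-qf v p × eval-qf v q
eval-qf v (p ∨ᶠ q) = eval-qf v p ⊎ eval-qf v q
eval-qf v (p ⇒ᶠ q) = eval-qf v p → eval-qf v q

data Literal (S : Signature) (n : ℕ) : Set where
  pos neg : Atom S n → Literal S n

literal : Literal S n → Formula S n
literal (pos a) = atom a
literal (neg a) = ¬ᶠ atom a

eval-lit : Valuation S n → Literal S n → Set
eval-lit v (pos a) = v a
eval-lit v (neg a) = ¬ v a

-- A list of literals stands for its conjunction.
Cube : Signature → ℕ → Set
Cube S n = List (Literal S n)

conj : Cube S n → Formula S n
conj = ⋀ ∘ map literal

Implicant : {β : Formula S n} → QuantifierFree β → Cube S n → Set₁
Implicant β π = ∀ v → All (eval-lit v) π → eval-qf v β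

-- Every ordering of a prime implicant is admitted, so that a call can be
-- singled out with any prefix and suffix.
record PrimeImplicant {β : Formula S n} (qf : QuantifierFree β) (π : Cube S n) : Set₁ where
  field
    unique     : Unique π
    consistent : ∀ {a} → pos a ∈ π → ¬ (neg a ∈ π)
    implicant  : Implicant qf π
    minimal    : ∀ {π′} → π′ ⊆ᴸ π → Implicant qf π′ → π ⊆ᴸ π′

-- S extended with one predicate symbol Σ_P = inj₂ P per procedure P.
extend : Signature → {m : ℕ} → (Fin m → ℕ) → Signature
functions (extend S ar) = functions S
Symbol (relations (extend S {m} ar)) = Symbol (relations S) ⊎ Fin m
arity  (relations (extend S ar)) = [ arity (relations S) , ar ]′

mutual
  OnlyPositive : {m : ℕ} {ar : Fin m → ℕ} → Formula (extend S ar) n → Set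
  OnlyPositive (atom _) = ⊤
  OnlyPositive ⊤ᶠ       = ⊤
  OnlyPositive ⊥ᶠ       = ⊤
  OnlyPositive (φ ∧ᶠ ψ) = OnlyPositive φ × OnlyPositive ψ
  OnlyPositive (φ ∨ᶠ ψ) = OnlyPositive φ × OnlyPositive ψ
  OnlyPositive (φ ⇒ᶠ ψ) = OnlyNegative φ × OnlyPositive ψ
  OnlyPositive (∃ᶠ φ)   = OnlyPositive φ
  OnlyPositive (∀ᶠ φ)   = OnlyPositive φ

  OnlyNegative : {m : ℕ} {ar : Fin m → ℕ} → Formula (extend S ar) n → Set
  OnlyNegative (atom (_ ≐ _))        = ⊤
  OnlyNegative (atom (rel (inj₁ _) _)) = ⊤
  OnlyNegative (atom (rel (inj₂ _) _)) = ⊥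
  OnlyNegative ⊤ᶠ       = ⊤
  OnlyNegative ⊥ᶠ       = ⊤
  OnlyNegative (φ ∧ᶠ ψ) = OnlyNegative φ × OnlyNegative ψ
  OnlyNegative (φ ∨ᶠ ψ) = OnlyNegative φ × OnlyNegative ψ
  OnlyNegative (φ ⇒ᶠ ψ) = OnlyPositive φ × OnlyNegative ψ
  OnlyNegative (∃ᶠ φ)   = OnlyNegative φ
  OnlyNegative (∀ᶠ φ)   = OnlyNegative φ

-- The variables of a body are the locals followed by v̄_P, the inputs
-- followed by the outputs; locals come first so that ∃* binds them.
record Program (S : Signature) : Set where
  field
    size                   : ℕ
    main                   : Fin size
    #inputs #outputs #locals : Fin size → ℕ

  Proc : Set
  Proc = Fin size

  #v : Proc → ℕ
  #v P = #inputs P + #outputs P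

  Sᴬ : Signature
  Sᴬ = extend S #v

  field
    body           : ∀ P → Formula Sᴬ (#locals P + #v P)
    quantifierFree : ∀ P → QuantifierFree (body P)
    positive       : ∀ P → OnlyPositive (body P)

module Semantics {S : Signature} (Th : Theory S) (A : Program S) where

  open Program A

  FormulaOver : Proc → Set
  FormulaOver P = Formula S (#v P)

  call : (P : Proc) → Vec (Term (functions S) n) (#v P) → Atom Sᴬ n
  call P = rel (inj₂ P)

  Σ[_] : (P : Proc) → Formula Sᴬ (#v P)
  Σ[ P ] = atom (call P (tabulate var))

  Path : (P : Proc) → Cube Sᴬ (#locals P + #v P) → Set₁
  Path P = PrimeImplicant (quantifierFree P)

  Interpretation : Structure S → Set₁
  Interpretation I = ∀ P → Pred (Vec ∣ I ∣ (#v P)) 0ℓ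

  J : (I : Structure S) → Interpretation I → Structure Sᴬ
  ∣ J I X ∣            = ∣ I ∣
  nonempty (J I X)       = nonempty I
  fun (J I X)            = fun I
  holds (J I X) (inj₁ r) = holds I r
  holds (J I X) (inj₂ P) = X P

  Solution : (I : Structure S) → Interpretation I → Set
  Solution I X = ∀ Q → Satisfies (J I X) (body Q ⇒ᶠ weaken (#locals Q) Σ[ Q ])

  -- The least solution, obtained as the intersection of all solutions.
  -- The intersection lives one universe up; by ⟦⟧-least it agrees with
  -- any solution that is least among the small ones.
  ⟦_⟧ : (P : Proc) (I : Structure S) → Pred (Vec ∣ I ∣ (#v P)) (lsuc 0ℓ)
  ⟦ P ⟧ I a = ∀ X → Solution I X → X P a

  LeastSolution : (I : Structure S) → Interpretation I → Set₁
  LeastSolution I X = Solution I X × (∀ Y → Solution I Y → ∀ P → X P ⊆ Y P)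

  ⟦⟧-least : ∀ I X → LeastSolution I X → ∀ P a → ⟦ P ⟧ I a ⇔ X P a
  ⟦⟧-least I X (sol , least) P a =
    mk⇔ (λ p → p X sol) (λ x Y solY → least Y solY P x)

  ⟦_⟧⟨_⟩ : (P : Proc) → ℕ → (I : Structure S) → Pred (Vec ∣ I ∣ (#v P)) 0ℓ
  ⟦ P ⟧⟨ zero ⟩  I = sat (J I (λ _ _ → ⊥)) (∃* (#locals P) (body P))
  ⟦ P ⟧⟨ suc b ⟩ I = sat (J I (λ Q → ⟦ Q ⟧⟨ b ⟩ I)) (∃* (#locals P) (body P))

  infix 4 _⊨ᴾ_ _⊨ᴾ⟨_⟩_

  _⊨ᴾ_ : (P : Proc) → FormulaOver P → Set₁
  P ⊨ᴾ φ = ∀ I → IsModel Th I → ⟦ P ⟧ I ⊆ sat I φ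

  _⊨ᴾ⟨_⟩_ : (P : Proc) → ℕ → FormulaOver P → Set₁
  P ⊨ᴾ⟨ b ⟩ φ = ∀ I → IsModel Th I → ⟦ P ⟧⟨ b ⟩ I ⊆ sat I φ

  -- (b , δ) ∈ m P says that δ belongs to the value of m at (P, b).  Only
  -- finitely many pairs are recorded, as U and O have to be formulas.

  AssertionMap : Set
  AssertionMap = ∀ P → List (ℕ × FormulaOver P)

  ∅ : AssertionMap
  ∅ _ = []

  add : AssertionMap → (P : Proc) → ℕ → FormulaOver P → AssertionMap
  add m P b ψ Q with P Fin.≟ Q
  ... | yes refl = (b , ψ) ∷ m Q
  ... | no _     = m Q

  -- The superscript b ranges over integers; the only negative one in use
  -- is -1 = pred (+ 0).
  U O : AssertionMap → ℤ → ∀ P → FormulaOver P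
  U m -[1+ _ ] P = ⊥ᶠ
  U m (+ b)    P = ⋁ (map proj₂ (filter (λ f → proj₁ f ≤? b) (m P)))
  O m -[1+ _ ] P = ⊥ᶠ
  O m (+ b)    P = ⋀ (map proj₂ (filter (λ f → proj₁ f ≥? b) (m P)))

  instantiate : (∀ P → FormulaOver P) → Formula Sᴬ n → Formula S n
  instantiate D (atom (t ≐ u))           = atom (t ≐ u)
  instantiate D (atom (rel (inj₁ r) ts)) = atom (rel r ts)
  instantiate D (atom (rel (inj₂ P) ts)) = subst (lookup ts) (D P)
  instantiate D ⊤ᶠ       = ⊤ᶠ
  instantiate D ⊥ᶠ       = ⊥ᶠ
  instantiate D (φ ∧ᶠ ψ) = instantiate D φ ∧ᶠ instantiate D ψ
  instantiate D (φ ∨ᶠ ψ) = instantiate D φ ∨ᶠ instantiate D ψ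
  instantiate D (φ ⇒ᶠ ψ) = instantiate D φ ⇒ᶠ instantiate D ψ
  instantiate D (∃ᶠ φ)   = ∃ᶠ instantiate D φ
  instantiate D (∀ᶠ φ)   = ∀ᶠ instantiate D φ

  -- ⟦_⟧[ ρ ]ᵁ b and ⟦_⟧[ σ ]ᴼ b render ⟦_⟧ᵇ_ρ and ⟦_⟧ᵇ_σ.
  ⟦_⟧[_]ᵁ ⟦_⟧[_]ᴼ : Formula Sᴬ n → AssertionMap → ℤ → Formula S n
  ⟦ τ ⟧[ ρ ]ᵁ b = instantiate (U ρ b) τ
  ⟦ τ ⟧[ σ ]ᴼ b = instantiate (O σ b) τ

  -- The formula (∃ x̄ ∖ ā. χ)[ā ← v̄_R], where ā are the arguments of a
  -- call of R.
  --
  -- A variable that is an argument is replaced by the matching v̄_R, any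
  -- other variable stays and is quantified.  When ā are distinct
  -- variables, as the notation presupposes, `residual` is empty.  For an
  -- argument that is a compound term or a repeated variable, it retains
  -- the equation between this argument and the matching v̄_R.

  module _ (ā : Vec (Term (functions S) k) l) where

    isVar? : (x : Fin n) (t : Term (functions S) n) → Dec (t ≡ var x)
    isVar? x (app f ts) = no λ ()
    isVar? x (var y) with y Fin.≟ x
    ... | yes refl = yes refl
    ... | no y≢x   = no λ { refl → y≢x refl }

    IsArgument : Fin k → Set
    IsArgument x = ∃[ j ] lookup ā j ≡ var x

    isArgument? : ∀ x → Dec (IsArgument x)
    isArgument? x = Fin.any? λ j → isVar? x (lookup ā j)

    remaining : List (Fin k)
    remaining = filter (¬? ∘ isArgument?) (allFin k)

    rename : Fin k → Term (functions S) (length remaining + l)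
    rename x with isArgument? x
    ... | yes (j , _) = var (length remaining ↑ʳ j)
    ... | no ¬arg     =
      var (index (∈-filter⁺ (¬? ∘ isArgument?) (∈-allFin x) ¬arg) ↑ˡ l)

    residual : List (Formula S (length remaining + l))
    residual =
      map (λ j → atom (var (length remaining ↑ʳ j) ≐ substᵗ rename (lookup ā j)))
          (filter (λ j → ¬? (isVar? (length remaining ↑ʳ j) (substᵗ rename (lookup ā j))))
                  (allFin l))

    project : Formula S k → Formula S l
    project χ = ∃* (length remaining) (foldr _∧ᶠ_ (subst rename χ) residual)

  record Query : Set where
    constructor ⟨_,_,_⟩
    field
      proc  : Proc
      goal  : FormulaOver proc
      bound : ℕ

  Queries : Set₂
  Queries = Pred Query (lsuc 0ℓ)

  ｛_｝ : Query → Queries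
  ｛ q ｝ q′ = Lift (lsuc 0ℓ) (q′ ≡ q)

  infix 3 _∥_∥_

  record State : Set₂ where
    constructor _∥_∥_
    field
      queries : Queries
      reached : AssertionMap
      summary : AssertionMap

  Summarized : AssertionMap → (P : Proc) → ℕ → FormulaOver P → Queries
  Summarized σ P b ψ q = ∃[ η ] ∃[ c ]
    q ≡ ⟨ P , η , c ⟩ × c ≤ b × Th ⊨ (⟦ Σ[ P ] ⟧[ σ ]ᴼ (+ c) ∧ᶠ ψ ⇒ᶠ ¬ᶠ η)

  Reached : (P : Proc) → ℕ → FormulaOver P → Queries
  Reached P b ψ q = ∃[ η ] ∃[ c ]
    q ≡ ⟨ P , η , c ⟩ × c ≥ b × Th ⊭ (ψ ⇒ᶠ ¬ᶠ η)

  infix 2 _⟶_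

  data _⟶_ : State → State → Set₂ where

    sum : ∀ {Q ρ σ P φ b} (ψ : FormulaOver P) →
      Q ⟨ P , φ , b ⟩ →
      Th ⊨ (⟦ body P ⟧[ σ ]ᴼ (pred (+ b)) ⇒ᶠ ¬ᶠ weaken (#locals P) φ) →
      Th ⊨ (⟦ body P ⟧[ σ ]ᴼ (pred (+ b)) ⇒ᶠ weaken (#locals P) ψ) →
      Th ⊨ (ψ ⇒ᶠ ¬ᶠ φ) →
      (Q ∥ ρ ∥ σ) ⟶ (Q ∖ Summarized σ P b ψ ∥ ρ ∥ add σ P b ψ)

    reach : ∀ {Q ρ σ P φ b} π →
      Q ⟨ P , φ , b ⟩ →
      Path P π →
      Th ⊭ (⟦ conj π ⟧[ ρ ]ᵁ (pred (+ b)) ⇒ᶠ ¬ᶠ weaken (#locals P) φ) →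
      let ψ = ∃* (#locals P) (⟦ conj π ⟧[ ρ ]ᵁ (pred (+ b))) in
      (Q ∥ ρ ∥ σ) ⟶ (Q ∖ Reached P b ψ ∥ add ρ P b ψ ∥ σ)

    -- The bound is suc b: the new query needs a bound ≥ 0, and at bound 0
    -- the last two premises contradict each other.
    query : ∀ {Q ρ σ P φ b R} πᵤ ā πᵥ →
      Q ⟨ P , φ , suc b ⟩ →
      Th ⊨ (⟦ body P ⟧[ ρ ]ᵁ (+ b) ⇒ᶠ ¬ᶠ weaken (#locals P) φ) →
      Path P (πᵤ ++ pos (call R ā) ∷ πᵥ) →
      Th ⊨ (⟦ conj πᵤ ⟧[ σ ]ᴼ (+ b) ∧ᶠ ⟦ atom (call R ā) ⟧[ ρ ]ᵁ (+ b)
              ∧ᶠ ⟦ conj πᵥ ⟧[ ρ ]ᵁ (+ b) ⇒ᶠ ¬ᶠ weaken (#locals P) φ) →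
      Th ⊭ (⟦ conj πᵤ ⟧[ σ ]ᴼ (+ b) ∧ᶠ ⟦ atom (call R ā) ⟧[ σ ]ᴼ (+ b)
              ∧ᶠ ⟦ conj πᵥ ⟧[ ρ ]ᵁ (+ b) ⇒ᶠ ¬ᶠ weaken (#locals P) φ) →
      let ψ = project ā (⟦ conj πᵤ ⟧[ σ ]ᴼ (+ b) ∧ᶠ ⟦ conj πᵥ ⟧[ ρ ]ᵁ (+ b)
                           ∧ᶠ weaken (#locals P) φ) in
      (∀ η → Q ⟨ R , η , b ⟩ → Th ⊨ (ψ ⇒ᶠ ¬ᶠ η)) →
      (Q ∥ ρ ∥ σ) ⟶ (Q ∪ ｛ ⟨ R , ψ , b ⟩ ｝ ∥ ρ ∥ σ)

  data Verdict : Set where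
    SAFE UNSAFE : Verdict

  -- BndSafety φ n ρᵢ σᵢ v ρ σ: some run returns v with final maps ρ and σ.
  data BndSafety (φ : FormulaOver main) (n : ℕ) (ρᵢ σᵢ : AssertionMap) :
       Verdict → AssertionMap → AssertionMap → Set₂ where

    unsafe : ∀ {Q ρ σ} →
      Star _⟶_ (｛ ⟨ main , ¬ᶠ φ , n ⟩ ｝ ∥ ρᵢ ∥ σᵢ) (Q ∥ ρ ∥ σ) →
      Empty Q →
      Th ⊭ (⟦ Σ[ main ] ⟧[ ρ ]ᵁ (+ n) ⇒ᶠ φ) →
      BndSafety φ n ρᵢ σᵢ UNSAFE ρ σ

    safe : ∀ {Q ρ σ} →
      Star _⟶_ (｛ ⟨ main , ¬ᶠ φ , n ⟩ ｝ ∥ ρᵢ ∥ σᵢ) (Q ∥ ρ ∥ σ) →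
      Empty Q →
      Th ⊨ (⟦ Σ[ main ] ⟧[ σ ]ᴼ (+ n) ⇒ᶠ φ) →
      BndSafety φ n ρᵢ σᵢ SAFE ρ σ

  Inductive : AssertionMap → ℕ → (P : Proc) → FormulaOver P → Set₁
  Inductive σ n P δ = Th ⊨ (⟦ body P ⟧[ σ ]ᴼ (+ n) ⇒ᶠ weaken (#locals P) δ)

  CheckSucceeds : AssertionMap → ℕ → Set₁
  CheckSucceeds σ n = ∀ P δ → (n , δ) ∈ σ P → Inductive σ n P δ

  -- σ′ is σ after CheckInductive at n.  All tests are made against σ:
  -- a fact added on the way already occurs at n, so it leaves the formulas
  -- O σ (+ n) unchanged up to equivalence.
  Propagated : AssertionMap → ℕ → AssertionMap → Set₁
  Propagated σ n σ′ = ∀ P b δ →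
    (b , δ) ∈ σ′ P ⇔ ((b , δ) ∈ σ P ⊎ (b ≡ suc n × (n , δ) ∈ σ P × Inductive σ n P δ))

  -- RecMCFrom φ n ρ σ v: the loop entered with n, ρ and σ can return v.
  data RecMCFrom (φ : FormulaOver main) (n : ℕ) (ρ σ : AssertionMap) :
       Verdict → Set₂ where

    unsafe : ∀ {ρ′ σ′} →
      BndSafety φ n ρ σ UNSAFE ρ′ σ′ →
      RecMCFrom φ n ρ σ UNSAFE

    safe : ∀ {ρ′ σ′} →
      BndSafety φ n ρ σ SAFE ρ′ σ′ →
      CheckSucceeds σ′ n →
      RecMCFrom φ n ρ σ SAFE

    continue : ∀ {ρ′ σ′ σ″ v} →
      BndSafety φ n ρ σ SAFE ρ′ σ′ →
      ¬ CheckSucceeds σ′ n →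
      Propagated σ′ n σ″ →
      RecMCFrom φ (suc n) ρ′ σ″ v →
      RecMCFrom φ n ρ σ v

  RecMC : FormulaOver main → Verdict → Set₂
  RecMC φ = RecMCFrom φ 0 ∅ ∅

{-# OPTIONS --safe #-}

-- Read a program body as the operator on interpretations of the procedure
-- symbols that sends X to the meaning of ∃ℓ̄. β under X.  Positivity of the
-- bodies makes it monotone, so the bounded semantics increase with the bound
-- and stay below every solution.  Hence the transitions preserve three facts:
-- δ ∈ ρ(P, b) lies below ⟦P⟧ᵇ, δ ∈ σ(P, b) lies above ⟦P⟧ᵇ, and no query or
-- summary of a run at n has a bound beyond n.  By the last fact, success of
-- CheckInductive at n makes every conjunct of O σ n inductive, so O σ n is a
-- solution and lies above the least one.

module Submission where

open import Data.Empty using (⊥)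
open import Data.Fin using (Fin; _↑ʳ_)
import Data.Fin as Fin
open import Data.Integer using (+_; pred)
open import Data.List using (List; []; _∷_; map; filter)
open import Data.List.Membership.Propositional using (_∈_; find)
open import Data.List.Membership.Propositional.Properties using (∈-filter⁻)
open import Data.List.Relation.Unary.All using (All; []; _∷_)
import Data.List.Relation.Unary.All as All
import Data.List.Relation.Unary.All.Properties as All
open import Data.List.Relation.Unary.Any using (Any; here; there)
import Data.List.Relation.Unary.Any.Properties as Any
open import Data.Nat using (ℕ; zero; suc; _+_; _≤_; _≤?_; _≥?_; z≤n; s≤s)
open import Data.Nat.Properties using (≤-refl; ≤-antisym; <⇒≤; m≤n⇒m≤1+n)
open import Data.Product using (_×_; _,_; proj₁; proj₂; ∃; ∃-syntax; map₂)
open import Data.Product.Function.NonDependent.Propositional using (_×-⇔_)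
open import Data.Sum using (inj₁; inj₂)
import Data.Sum as Sum
open import Data.Sum.Function.Propositional using (_⊎-⇔_)
open import Data.Unit using (tt)
open import Data.Vec using (Vec; []; _∷_; _++_; lookup; tabulate; splitAt)
open import Data.Vec.Properties using (lookup-++ʳ)
open import Function using (_∘_; id; _⇔_; mk⇔; Equivalence)
open import Function.Construct.Identity using (⇔-id)
open import Function.Related.TypeIsomorphisms using (→-cong-⇔)
open import Level using (Level; lift)
open import Relation.Binary.Construct.Closure.ReflexiveTransitive using (Star; ε; _◅_)
open import Relation.Binary.PropositionalEquality
  using (_≡_; refl; trans; cong; cong₂)
open import Relation.Nullary using (¬_; yes; no)
open import Relation.Unary using (_⊆_)

open import Defs renaming (lift to liftˢ)

open Equivalence using (to; from)

private
  variable
    S : Signature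
    k l n : ℕ
    ℓ : Level

≡⇒⇔ : {X Y : Set} → X ≡ Y → X ⇔ Y
≡⇒⇔ refl = ⇔-id _

-- Substitution, quantifier blocks and implicants in a fixed structure.

module _ (I : Structure S) where

  mutual
    eval-substᵗ : {s : Fin k → Term (functions S) n} {e : Vec ∣ I ∣ n} {e′ : Vec ∣ I ∣ k} →
                  (∀ x → eval I e (s x) ≡ lookup e′ x) →
                  ∀ t → eval I e (substᵗ s t) ≡ eval I e′ t
    eval-substᵗ s≡ (var x)    = s≡ x
    eval-substᵗ s≡ (app f ts) = cong (fun I f) (evals-substᵗˢ s≡ ts)

    evals-substᵗˢ : {s : Fin k → Term (functions S) n} {e : Vec ∣ I ∣ n} {e′ : Vec ∣ I ∣ k} →
                    (∀ x → eval I e (s x) ≡ lookup e′ x) →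
                    (ts : Vec (Term (functions S) k) l) →
                    evals I e (substᵗˢ s ts) ≡ evals I e′ ts
    evals-substᵗˢ s≡ []       = refl
    evals-substᵗˢ s≡ (t ∷ ts) = cong₂ _∷_ (eval-substᵗ s≡ t) (evals-substᵗˢ s≡ ts)

  eval-lift : {s : Fin k → Term (functions S) n} {e : Vec ∣ I ∣ n} {e′ : Vec ∣ I ∣ k} →
              (∀ x → eval I e (s x) ≡ lookup e′ x) →
              ∀ d x → eval I (d ∷ e) (liftˢ s x) ≡ lookup (d ∷ e′) x
  eval-lift         s≡ d Fin.zero    = refl
  eval-lift {s = s} s≡ d (Fin.suc x) = trans (eval-substᵗ (λ _ → refl) (s x)) (s≡ x)

  -- `e′` is described by its lookups instead of being built from `s`: `eval-lift` restores the
  -- description under a binder, and weakening and argument passing are direct instances.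
  sat-subst : (φ : Formula S k) {s : Fin k → Term (functions S) n}
              {e : Vec ∣ I ∣ n} {e′ : Vec ∣ I ∣ k} →
              (∀ x → eval I e (s x) ≡ lookup e′ x) →
              sat I (subst s φ) e ⇔ sat I φ e′
  sat-subst (atom (t ≐ u))    s≡ = ≡⇒⇔ (cong₂ _≡_ (eval-substᵗ s≡ t) (eval-substᵗ s≡ u))
  sat-subst (atom (rel r ts)) s≡ = ≡⇒⇔ (cong (holds I r) (evals-substᵗˢ s≡ ts))
  sat-subst ⊤ᶠ       s≡ = ⇔-id _
  sat-subst ⊥ᶠ       s≡ = ⇔-id _
  sat-subst (φ ∧ᶠ ψ) s≡ = sat-subst φ s≡ ×-⇔ sat-subst ψ s≡
  sat-subst (φ ∨ᶠ ψ) s≡ = sat-subst φ s≡ ⊎-⇔ sat-subst ψ s≡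
  sat-subst (φ ⇒ᶠ ψ) s≡ = →-cong-⇔ (sat-subst φ s≡) (sat-subst ψ s≡)
  sat-subst (∃ᶠ φ)   s≡ = mk⇔ (map₂ λ {d} → to   (sat-subst φ (eval-lift s≡ d)))
                              (map₂ λ {d} → from (sat-subst φ (eval-lift s≡ d)))
  sat-subst (∀ᶠ φ)   s≡ = mk⇔ (λ p d → to   (sat-subst φ (eval-lift s≡ d)) (p d))
                              (λ p d → from (sat-subst φ (eval-lift s≡ d)) (p d))

  sat-weaken : (φ : Formula S n) (a : Vec ∣ I ∣ l) {e : Vec ∣ I ∣ n} →
               sat I (weaken l φ) (a ++ e) ⇔ sat I φ e
  sat-weaken φ a {e} = sat-subst φ (lookup-++ʳ a e)

  eval-lookup : (e : Vec ∣ I ∣ n) (ts : Vec (Term (functions S) n) k) (x : Fin k) →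
                eval I e (lookup ts x) ≡ lookup (evals I e ts) x
  eval-lookup e (t ∷ ts) Fin.zero    = refl
  eval-lookup e (t ∷ ts) (Fin.suc x) = eval-lookup e ts x

  -- Stated for arbitrary `s` and `e′` so that the induction goes through: the tail of
  -- `tabulate var` is `tabulate (var ∘ Fin.suc)`, still evaluated in the whole of `e`.
  evals-tabulate : (e : Vec ∣ I ∣ n) (s : Fin k → Term (functions S) n) {e′ : Vec ∣ I ∣ k} →
                   (∀ x → eval I e (s x) ≡ lookup e′ x) →
                   evals I e (tabulate s) ≡ e′
  evals-tabulate e s {[]}     s≡ = refl
  evals-tabulate e s {d ∷ e′} s≡ =
    cong₂ _∷_ (s≡ Fin.zero) (evals-tabulate e (s ∘ Fin.suc) (s≡ ∘ Fin.suc))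

  evals-variables : (e : Vec ∣ I ∣ n) → evals I e (tabulate var) ≡ e
  evals-variables e = evals-tabulate e var λ _ → refl

  sat-∃* : ∀ l (φ : Formula S (l + n)) {e : Vec ∣ I ∣ n} →
           sat I (∃* l φ) e ⇔ (∃[ a ] sat I φ (a ++ e))
  sat-∃* zero    φ = mk⇔ ([] ,_) λ { ([] , p) → p }
  sat-∃* (suc l) φ = mk⇔
    -- `∃*` puts each further quantifier innermost, where it binds variable 0, so its witness `d`
    -- goes in front of the others.
    (λ p → let a , d , q = to (sat-∃* l (∃ᶠ φ)) p in d ∷ a , q)
    (λ { (d ∷ a , q) → from (sat-∃* l (∃ᶠ φ)) (a , d , q) })

  sat-⋁⁻ : (φs : List (Formula S n)) {e : Vec ∣ I ∣ n} →
           sat I (⋁ φs) e → Any (λ φ → sat I φ e) φs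
  sat-⋁⁻ (φ ∷ φs) (inj₁ p) = here p
  sat-⋁⁻ (φ ∷ φs) (inj₂ p) = there (sat-⋁⁻ φs p)

  sat-⋀⁺ : {φs : List (Formula S n)} {e : Vec ∣ I ∣ n} →
           All (λ φ → sat I φ e) φs → sat I (⋀ φs) e
  sat-⋀⁺ []       = tt
  sat-⋀⁺ (p ∷ ps) = p , sat-⋀⁺ ps

  valuation : Vec ∣ I ∣ n → Valuation S n
  valuation e a = satᵃ I a e

  sat-conj⁻ : (π : Cube S n) {e : Vec ∣ I ∣ n} →
              sat I (conj π) e → All (eval-lit (valuation e)) π
  sat-conj⁻ []          _        = []
  sat-conj⁻ (pos a ∷ π) (p , ps) = p ∷ sat-conj⁻ π ps
  sat-conj⁻ (neg a ∷ π) (p , ps) = p ∷ sat-conj⁻ π ps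

  eval-qf⇔sat : {β : Formula S n} (qf : QuantifierFree β) {e : Vec ∣ I ∣ n} →
                eval-qf (valuation e) qf ⇔ sat I β e
  eval-qf⇔sat (atom a) = ⇔-id _
  eval-qf⇔sat ⊤ᶠ       = ⇔-id _
  eval-qf⇔sat ⊥ᶠ       = ⇔-id _
  eval-qf⇔sat (p ∧ᶠ q) = eval-qf⇔sat p ×-⇔ eval-qf⇔sat q
  eval-qf⇔sat (p ∨ᶠ q) = eval-qf⇔sat p ⊎-⇔ eval-qf⇔sat q
  eval-qf⇔sat (p ⇒ᶠ q) = →-cong-⇔ (eval-qf⇔sat p) (eval-qf⇔sat q)

  -- `Implicant` ranges over all valuations of the atoms, in particular over the one that `I` and
  -- the environment induce.
  sat-implicant : {β : Formula S n} (qf : QuantifierFree β) {π : Cube S n} →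
                  Implicant qf π → sat I (conj π) ⊆ sat I β
  sat-implicant qf {π} imp p = to (eval-qf⇔sat qf) (imp _ (sat-conj⁻ π p))

module Soundness {S : Signature} (Th : Theory S) (A : Program S) where

  open Program A
  open Semantics Th A

  -- Instantiated formulas and the expansion `J I X`.

  module _ (I : Structure S) where

    mutual
      -- `J I X` has the functions of `I`, but `eval` recurses on the term, so for a variable `t`
      -- the two sides do not agree by computation.
      eval-J : ∀ X (e : Vec ∣ I ∣ n) t → eval (J I X) e t ≡ eval I e t
      eval-J X e (var x)    = refl
      eval-J X e (app f ts) = cong (fun I f) (evals-J X e ts)

      evals-J : ∀ X (e : Vec ∣ I ∣ n) (ts : Vec (Term (functions S) n) k) →
                evals (J I X) e ts ≡ evals I e ts
      evals-J X e []       = refl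
      evals-J X e (t ∷ ts) = cong₂ _∷_ (eval-J X e t) (evals-J X e ts)

    sat-≐-J : ∀ X (e : Vec ∣ I ∣ n) t u →
              satᵃ (J I X) (t ≐ u) e ⇔ satᵃ I (t ≐ u) e
    sat-≐-J X e t u = ≡⇒⇔ (cong₂ _≡_ (eval-J X e t) (eval-J X e u))

    sat-rel-J : ∀ X (e : Vec ∣ I ∣ n) r ts →
                satᵃ (J I X) (rel (inj₁ r) ts) e ⇔ satᵃ I (rel r ts) e
    sat-rel-J X e r ts = ≡⇒⇔ (cong (holds I r) (evals-J X e ts))

    sat-call : ∀ X (e : Vec ∣ I ∣ n) P ts →
               satᵃ (J I X) (call P ts) e ⇔ X P (evals I e ts)
    sat-call X e P ts = ≡⇒⇔ (cong (X P) (evals-J X e ts))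

    sat-Σ : ∀ X P {a} → sat (J I X) Σ[ P ] a ⇔ X P a
    sat-Σ X P {a} = ≡⇒⇔ (cong (X P) (evals-variables (J I X) a))

    -- Replacing each procedure symbol by a formula amounts to expanding `I` by the sets that these
    -- formulas define. This carries the premises of the rules over to `J`, where monotonicity
    -- applies.
    sat-instantiate : ∀ D (φ : Formula Sᴬ n) {e : Vec ∣ I ∣ n} →
                      sat I (instantiate D φ) e ⇔ sat (J I (sat I ∘ D)) φ e
    sat-instantiate D (atom (t ≐ u)) {e} =
      mk⇔ (from (sat-≐-J _ e t u)) (to (sat-≐-J _ e t u))
    sat-instantiate D (atom (rel (inj₁ r) ts)) {e} =
      mk⇔ (from (sat-rel-J _ e r ts)) (to (sat-rel-J _ e r ts))
    sat-instantiate D (atom (rel (inj₂ P) ts)) {e} =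
      mk⇔ (from call⇔ ∘ to subst⇔) (from subst⇔ ∘ to call⇔)
      where
      call⇔ : sat (J I (sat I ∘ D)) (atom (call P ts)) e ⇔ sat I (D P) (evals I e ts)
      call⇔ = sat-call (sat I ∘ D) e P ts

      subst⇔ : sat I (subst (lookup ts) (D P)) e ⇔ sat I (D P) (evals I e ts)
      subst⇔ = sat-subst I (D P) (eval-lookup I e ts)
    sat-instantiate D ⊤ᶠ       = ⇔-id _
    sat-instantiate D ⊥ᶠ       = ⇔-id _
    sat-instantiate D (φ ∧ᶠ ψ) = sat-instantiate D φ ×-⇔ sat-instantiate D ψ
    sat-instantiate D (φ ∨ᶠ ψ) = sat-instantiate D φ ⊎-⇔ sat-instantiate D ψ
    sat-instantiate D (φ ⇒ᶠ ψ) = →-cong-⇔ (sat-instantiate D φ) (sat-instantiate D ψ)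
    sat-instantiate D (∃ᶠ φ)   = mk⇔ (map₂ (to (sat-instantiate D φ)))
                                     (map₂ (from (sat-instantiate D φ)))
    sat-instantiate D (∀ᶠ φ)   = mk⇔ (λ p d → to (sat-instantiate D φ) (p d))
                                     (λ p d → from (sat-instantiate D φ) (p d))

    sat-instantiate-Σ : ∀ D P {a} → sat I (instantiate D Σ[ P ]) a ⇔ sat I (D P) a
    sat-instantiate-Σ D P =
      mk⇔ (to (sat-Σ (sat I ∘ D) P) ∘ to (sat-instantiate D Σ[ P ]))
          (from (sat-instantiate D Σ[ P ]) ∘ from (sat-Σ (sat I ∘ D) P))

    -- Monotonicity, bounded semantics and solutions.

    infix 4 _⊑_

    _⊑_ : Interpretation I → Interpretation I → Set
    X ⊑ Y = ∀ P → X P ⊆ Y P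

    module _ {X Y : Interpretation I} (X⊑Y : X ⊑ Y) where

      mutual
        -- An implication flips the polarity of its antecedent, hence the mutual induction. A call
        -- has no clause in `sat-mono⁻`, since `OnlyNegative` is empty there.
        sat-mono⁺ : (φ : Formula Sᴬ n) → OnlyPositive φ →
                    sat (J I X) φ ⊆ sat (J I Y) φ
        sat-mono⁺ (atom (t ≐ u)) _ {e} = from (sat-≐-J Y e t u) ∘ to (sat-≐-J X e t u)
        sat-mono⁺ (atom (rel (inj₁ r) ts)) _ {e} =
          from (sat-rel-J Y e r ts) ∘ to (sat-rel-J X e r ts)
        sat-mono⁺ (atom (rel (inj₂ P) ts)) _ {e} =
          from (sat-call Y e P ts) ∘ X⊑Y P ∘ to (sat-call X e P ts)
        sat-mono⁺ ⊤ᶠ       _       = id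
        sat-mono⁺ ⊥ᶠ       _       = id
        sat-mono⁺ (φ ∧ᶠ ψ) (p , q) (x , y) = sat-mono⁺ φ p x , sat-mono⁺ ψ q y
        sat-mono⁺ (φ ∨ᶠ ψ) (p , q) = Sum.map (sat-mono⁺ φ p) (sat-mono⁺ ψ q)
        sat-mono⁺ (φ ⇒ᶠ ψ) (p , q) f = sat-mono⁺ ψ q ∘ f ∘ sat-mono⁻ φ p
        sat-mono⁺ (∃ᶠ φ)   p       = map₂ (sat-mono⁺ φ p)
        sat-mono⁺ (∀ᶠ φ)   p f d   = sat-mono⁺ φ p (f d)

        sat-mono⁻ : (φ : Formula Sᴬ n) → OnlyNegative φ →
                    sat (J I Y) φ ⊆ sat (J I X) φ
        sat-mono⁻ (atom (t ≐ u)) _ {e} = from (sat-≐-J X e t u) ∘ to (sat-≐-J Y e t u)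
        sat-mono⁻ (atom (rel (inj₁ r) ts)) _ {e} =
          from (sat-rel-J X e r ts) ∘ to (sat-rel-J Y e r ts)
        sat-mono⁻ ⊤ᶠ       _       = id
        sat-mono⁻ ⊥ᶠ       _       = id
        sat-mono⁻ (φ ∧ᶠ ψ) (p , q) (x , y) = sat-mono⁻ φ p x , sat-mono⁻ ψ q y
        sat-mono⁻ (φ ∨ᶠ ψ) (p , q) = Sum.map (sat-mono⁻ φ p) (sat-mono⁻ ψ q)
        sat-mono⁻ (φ ⇒ᶠ ψ) (p , q) f = sat-mono⁻ ψ q ∘ f ∘ sat-mono⁺ φ p
        sat-mono⁻ (∃ᶠ φ)   p       = map₂ (sat-mono⁻ φ p)
        sat-mono⁻ (∀ᶠ φ)   p f d   = sat-mono⁻ φ p (f d)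

    step : Interpretation I → Interpretation I
    step X P a = ∃ λ (d : Vec ∣ I ∣ (#locals P)) → sat (J I X) (body P) (d ++ a)

    step-mono : ∀ {X Y} → X ⊑ Y → step X ⊑ step Y
    step-mono X⊑Y P = map₂ (sat-mono⁺ X⊑Y (body P) (positive P))

    -- The interpretation ⟦_⟧⟨ b - 1 ⟩, which is empty for b = 0.
    below : ℕ → Interpretation I
    below zero    _ _ = ⊥
    below (suc b) P   = ⟦ P ⟧⟨ b ⟩ I

    -- Through `below`, bound 0 is also one application of `step`, namely to the empty
    -- interpretation, so `under-reach` and `over-sum` treat all bounds alike.
    unfold : ∀ b P {a} → ⟦ P ⟧⟨ b ⟩ I a ⇔ step (below b) P a
    unfold zero    P = sat-∃* (J I (below 0)) (#locals P) (body P)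
    unfold (suc b) P = sat-∃* (J I (below (suc b))) (#locals P) (body P)

    below-suc : ∀ b → below b ⊑ below (suc b)
    below-suc zero    P ()
    below-suc (suc b) P =
      from (unfold (suc b) P) ∘ step-mono (below-suc b) P ∘ to (unfold b P)

    bounded-mono : ∀ {b c} → b ≤ c → ∀ P → ⟦ P ⟧⟨ b ⟩ I ⊆ ⟦ P ⟧⟨ c ⟩ I
    bounded-mono {c = zero}  z≤n P p = p
    -- `below` is shifted by one: `below-suc (suc c)` compares the bounds `c` and `suc c`.
    bounded-mono {c = suc c} z≤n P p = below-suc (suc c) P (bounded-mono {c = c} z≤n P p)
    bounded-mono {suc b} {suc c} (s≤s b≤c) P =
      from (unfold (suc c) P) ∘ step-mono (λ Q → bounded-mono b≤c Q) P ∘ to (unfold (suc b) P)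

    -- The locals do not occur in the head `Σ[ P ]`, so quantifying them universally over the
    -- implication is quantifying them existentially in its antecedent. With the converse below,
    -- solutions are the pre-fixed points of `step`.
    solution⇒step⊑ : ∀ {X} → Solution I X → step X ⊑ X
    solution⇒step⊑ {X} sol P (d , p) =
      to (sat-Σ X P) (to (sat-weaken (J I X) Σ[ P ] d) (sol P _ p))

    step⊑⇒solution : ∀ {X} → step X ⊑ X → Solution I X
    step⊑⇒solution {X} pre P e p with splitAt (#locals P) e
    ... | d , a , refl =
      from (sat-weaken (J I X) Σ[ P ] d) (from (sat-Σ X P) (pre P (d , p)))

    below⊑solution : ∀ {X} → Solution I X → ∀ b → below b ⊑ X
    below⊑solution sol zero    P ()
    below⊑solution sol (suc b) P p =
      solution⇒step⊑ sol P (step-mono (below⊑solution sol b) P (to (unfold b P) p))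

    bounded⊆least : ∀ b P → ⟦ P ⟧⟨ b ⟩ I ⊆ ⟦ P ⟧ I
    bounded⊆least b P p X sol = below⊑solution sol (suc b) P p

    -- The common form of the premise of Sum and the test of CheckInductive.
    step-instantiate : ∀ D {P} (ψ : FormulaOver P) →
      Satisfies I (instantiate D (body P) ⇒ᶠ weaken (#locals P) ψ) →
      step (sat I ∘ D) P ⊆ sat I ψ
    step-instantiate D {P} ψ v (d , p) =
      to (sat-weaken I ψ d) (v _ (from (sat-instantiate D (body P)) p))

  -- Invariants of the assertion maps.

  Everywhere : (∀ P → ℕ → FormulaOver P → Set ℓ) → AssertionMap → Set ℓ
  Everywhere R m = ∀ P {b δ} → (b , δ) ∈ m P → R P b δ

  everywhere-add : (R : ∀ P → ℕ → FormulaOver P → Set ℓ) →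
                   ∀ {m P b ψ} → Everywhere R m → R P b ψ → Everywhere R (add m P b ψ)
  everywhere-add R {P = P} all r Q δ∈ with P Fin.≟ Q
  everywhere-add R all r Q (here refl) | yes refl = r
  everywhere-add R all r Q (there δ∈)  | yes refl = all Q δ∈
  everywhere-add R all r Q δ∈          | no _     = all Q δ∈

  Under Over : ∀ P → ℕ → FormulaOver P → Set₁
  Under P b δ = ∀ I → IsModel Th I → sat I δ ⊆ ⟦ P ⟧⟨ b ⟩ I
  Over  P b δ = P ⊨ᴾ⟨ b ⟩ δ

  Within : ℕ → ∀ P → ℕ → FormulaOver P → Set
  Within n _ b _ = b ≤ n

  module _ {ρ : AssertionMap} (under : Everywhere Under ρ) where

    module _ (I : Structure S) (mod : IsModel Th I) where

      -- A disjunct comes from a bound `c ≤ b`, and the bounded semantics grow from `c` to `b`.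
      U⊆bounded : ∀ b P → sat I (U ρ (+ b) P) ⊆ ⟦ P ⟧⟨ b ⟩ I
      U⊆bounded b P p with find (Any.map⁻ (sat-⋁⁻ I (map proj₂ (filter _ (ρ P))) p))
      ... | (c , δ) , δ∈ , q with ∈-filter⁻ (λ f → proj₁ f ≤? b) {xs = ρ P} δ∈
      ... | δ∈ρ , c≤b = bounded-mono I c≤b P (under P δ∈ρ I mod q)

      U⊑below : ∀ b → _⊑_ I (sat I ∘ U ρ (pred (+ b))) (below I b)
      U⊑below zero    P ()
      U⊑below (suc b) P = U⊆bounded b P

    under-reach : ∀ {P π} b → Path P π →
                  Under P b (∃* (#locals P) (⟦ conj π ⟧[ ρ ]ᵁ (pred (+ b))))
    under-reach {P} {π} b path I mod p =
      let d , q = to (sat-∃* I (#locals P) (⟦ conj π ⟧[ ρ ]ᵁ (pred (+ b)))) p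
          -- Back in the extended signature, calls are ordinary atoms, so the path implies the body
          -- there.
          body-holds = sat-implicant (J I (sat I ∘ U ρ (pred (+ b)))) (quantifierFree P)
                         (PrimeImplicant.implicant path)
                         (to (sat-instantiate I (U ρ (pred (+ b))) (conj π)) q)
      in from (unfold I b P) (step-mono I (U⊑below I mod b) P (d , body-holds))

  module _ {σ : AssertionMap} (over : Everywhere Over σ) where

    module _ (I : Structure S) (mod : IsModel Th I) where

      bounded⊆O : ∀ b P → ⟦ P ⟧⟨ b ⟩ I ⊆ sat I (O σ (+ b) P)
      bounded⊆O b P {a} p = sat-⋀⁺ I (All.map⁺ (All.tabulate fact))
        where
        fact : ∀ {f} → f ∈ filter (λ f → proj₁ f ≥? b) (σ P) → sat I (proj₂ f) a
        fact f∈ with ∈-filter⁻ (λ f → proj₁ f ≥? b) {xs = σ P} f∈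
        ... | f∈σ , b≤c = over P f∈σ I mod (bounded-mono I b≤c P p)

      below⊑O : ∀ b → _⊑_ I (below I b) (sat I ∘ O σ (pred (+ b)))
      -- At `-1` even the strongest summary `⊥ᶠ` is an overapproximation, because `below I 0` is
      -- empty.
      below⊑O zero    P ()
      below⊑O (suc b) P = bounded⊆O b P

    -- Monotonicity turns an overapproximation of the callees into one of the caller. It serves Sum,
    -- and CheckInductive with `b = suc n`.
    over-sum : ∀ {P ψ} b →
               Th ⊨ (⟦ body P ⟧[ σ ]ᴼ (pred (+ b)) ⇒ᶠ weaken (#locals P) ψ) →
               Over P b ψ
    over-sum {P} {ψ} b v I mod p =
      step-instantiate I (O σ (pred (+ b))) ψ (v I mod)
        (step-mono I (below⊑O I mod b) P (to (unfold I b P) p))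

  -- Preservation of the invariants by runs, and the verdicts of BndSafety.

  record Sound (n : ℕ) (ρ σ : AssertionMap) : Set₁ where
    field
      under  : Everywhere Under ρ
      over   : Everywhere Over σ
      within : Everywhere (Within n) σ

  open Sound

  sound-∅ : ∀ n → Sound n ∅ ∅
  sound-∅ n = record { under = λ _ () ; over = λ _ () ; within = λ _ () }

  QueriesWithin : ℕ → Queries → Set₁
  QueriesWithin n Q = ∀ q → Q q → Query.bound q ≤ n

  -- A new fact carries the bound of the query that triggers it, so the bounds in `Q` control those
  -- in `σ`.
  transition-sound : ∀ {n Q ρ σ Q′ ρ′ σ′} → (Q ∥ ρ ∥ σ) ⟶ (Q′ ∥ ρ′ ∥ σ′) →
    QueriesWithin n Q → Sound n ρ σ → QueriesWithin n Q′ × Sound n ρ′ σ′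
  transition-sound {n} (sum {P = P} {b = b} ψ q _ v _) qs s =
    (λ { q′ (p , _) → qs q′ p }) ,
    record
      { under  = under s
      ; over   = everywhere-add Over (over s) (over-sum (over s) {ψ = ψ} b v)
      ; within = everywhere-add (Within n) {P = P} {ψ = ψ} (within s) (qs _ q)
      }
  transition-sound (reach {b = b} π q path _) qs s =
    (λ { q′ (p , _) → qs q′ p }) ,
    record
      { under  = everywhere-add Under (under s) (under-reach (under s) b path)
      ; over   = over s
      ; within = within s
      }
  transition-sound (query _ _ _ q _ _ _ _ _) qs s =
    -- The new query has bound `b`, the one that triggers it `suc b`.
    (λ { q′ (inj₁ p) → qs q′ p ; _ (inj₂ (lift refl)) → <⇒≤ (qs _ q) }) , s

  run-sound : ∀ {n Q ρ σ Q′ ρ′ σ′} → Star _⟶_ (Q ∥ ρ ∥ σ) (Q′ ∥ ρ′ ∥ σ′) →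
    QueriesWithin n Q → Sound n ρ σ → Sound n ρ′ σ′
  run-sound ε        qs s = s
  run-sound (t ◅ ts) qs s = let qs′ , s′ = transition-sound t qs s in run-sound ts qs′ s′

  module _ {φ : FormulaOver main} {n : ℕ} {ρ σ ρ′ σ′ : AssertionMap} where

    BndSafety-preserves : ∀ {v} → BndSafety φ n ρ σ v ρ′ σ′ → Sound n ρ σ → Sound n ρ′ σ′
    BndSafety-preserves (unsafe ts _ _) = run-sound ts λ { _ (lift refl) → ≤-refl }
    BndSafety-preserves (safe ts _ _)   = run-sound ts λ { _ (lift refl) → ≤-refl }

    -- Stops at `O` because two sets are later placed inside it: the semantics bounded by `n` and,
    -- after a successful check, the least solution.
    BndSafety-SAFE : BndSafety φ n ρ σ SAFE ρ′ σ′ →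
                     ∀ I → IsModel Th I → sat I (O σ′ (+ n) main) ⊆ sat I φ
    BndSafety-SAFE (safe _ _ v) I mod p =
      v I mod _ (from (sat-instantiate-Σ I (O σ′ (+ n)) main) p)

    -- If the property held at `n`, the facts in `ρ′` would inherit it, which is the validity that
    -- the verdict denies; no countermodel has to be extracted.
    BndSafety-unsafe-sound : Sound n ρ σ → BndSafety φ n ρ σ UNSAFE ρ′ σ′ →
                             ¬ (main ⊨ᴾ⟨ n ⟩ φ)
    BndSafety-unsafe-sound s r@(unsafe _ _ ¬v) m⊨φ = ¬v λ I mod a p →
      m⊨φ I mod (U⊆bounded (under (BndSafety-preserves r s)) I mod n main
                  (to (sat-instantiate-Σ I (U ρ′ (+ n)) main) p))

    BndSafety-safe-sound : Sound n ρ σ → BndSafety φ n ρ σ SAFE ρ′ σ′ → main ⊨ᴾ⟨ n ⟩ φ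
    BndSafety-safe-sound s r I mod p =
      BndSafety-SAFE r I mod (bounded⊆O (over (BndSafety-preserves r s)) I mod n main p)

  -- CheckInductive and the loop of RecMC.

  propagate-sound : ∀ {n ρ σ σ′} → Propagated σ n σ′ → Sound n ρ σ → Sound (suc n) ρ σ′
  propagate-sound {n} {ρ} {σ} {σ′} prop s =
    record { under = under s ; over = over′ ; within = within′ }
    where
    over′ : Everywhere Over σ′
    over′ P {b} {δ} δ∈ with to (prop P b δ) δ∈
    ... | inj₁ δ∈σ            = over s P δ∈σ
    -- `+ n` is `pred (+ suc n)`, so the test at `n` is the premise of Sum for bound `suc n`.
    ... | inj₂ (refl , _ , v) = over-sum (over s) {ψ = δ} (suc n) v

    within′ : Everywhere (Within (suc n)) σ′
    within′ P {b} {δ} δ∈ with to (prop P b δ) δ∈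
    ... | inj₁ δ∈σ        = m≤n⇒m≤1+n (within s P δ∈σ)
    ... | inj₂ (refl , _) = ≤-refl

  O-solution : ∀ {n σ} → Everywhere (Within n) σ → CheckSucceeds σ n →
               ∀ I → IsModel Th I → Solution I (sat I ∘ O σ (+ n))
  O-solution {n} {σ} bounded check I mod = step⊑⇒solution I step-closed
    where
    step-closed : _⊑_ I (step I (sat I ∘ O σ (+ n))) (sat I ∘ O σ (+ n))
    step-closed P {a} p = sat-⋀⁺ I (All.map⁺ (All.tabulate fact))
      where
      fact : ∀ {f} → f ∈ filter (λ f → proj₁ f ≥? n) (σ P) → sat I (proj₂ f) a
      fact {c , δ} f∈ with ∈-filter⁻ (λ f → proj₁ f ≥? n) {xs = σ P} f∈
      -- The filter gives `n ≤ c` and `bounded` gives `c ≤ n`, so `δ` was recorded at `n` itself and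
      -- `check` covers it.
      ... | f∈σ , n≤c with ≤-antisym n≤c (bounded P f∈σ)
      ... | refl = step-instantiate I (O σ (+ n)) δ (check P δ f∈σ I mod) p

  RecMC-unsafe-sound : ∀ {φ n ρ σ} → Sound n ρ σ → RecMCFrom φ n ρ σ UNSAFE → ¬ (main ⊨ᴾ φ)
  RecMC-unsafe-sound {n = n} s (unsafe r) m⊨φ =
    -- What holds on the least solution holds on the bounded semantics inside it.
    BndSafety-unsafe-sound s r λ I mod p → m⊨φ I mod (bounded⊆least I n main p)
  RecMC-unsafe-sound s (continue r _ prop rec) =
    RecMC-unsafe-sound (propagate-sound prop (BndSafety-preserves r s)) rec

  RecMC-safe-sound : ∀ {φ n ρ σ} → Sound n ρ σ → RecMCFrom φ n ρ σ SAFE → main ⊨ᴾ φ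
  RecMC-safe-sound s (safe r check) I mod p =
    BndSafety-SAFE r I mod
      -- Membership in `⟦ main ⟧` is membership in every solution, here in the one given by `O` at
      -- `+ n`.
      (p _ (O-solution (within (BndSafety-preserves r s)) check I mod))
  RecMC-safe-sound s (continue r _ prop rec) =
    RecMC-safe-sound (propagate-sound prop (BndSafety-preserves r s)) rec

theorem1 :
    (S : Signature) (Th : Theory S) (A : Program S) →
    let open Program A using (main)
        open Semantics Th A
    in
    (φ : FormulaOver main) →
    ((n : ℕ) (ρ σ : AssertionMap) →
      (BndSafety φ n ∅ ∅ UNSAFE ρ σ → ¬ (main ⊨ᴾ⟨ n ⟩ φ)) ×
      (BndSafety φ n ∅ ∅ SAFE ρ σ → main ⊨ᴾ⟨ n ⟩ φ)) ×
    ((RecMC φ UNSAFE → ¬ (main ⊨ᴾ φ)) ×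
     (RecMC φ SAFE → main ⊨ᴾ φ))
theorem1 S Th A φ =
  (λ n ρ σ → BndSafety-unsafe-sound (sound-∅ n) , BndSafety-safe-sound (sound-∅ n)) ,
  RecMC-unsafe-sound (sound-∅ 0) , RecMC-safe-sound (sound-∅ 0)
  where open Soundness Th A
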